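{- Let $P$ be an Eulerian poset of rank $d\ge 3$ with $f$-vector $(f_{ -1},\dots,f_d)$. Then $\mathcal{M}_P(z)=\sum_{ -1\le i\le j\le d}N_{i,j}(-z)^{j-i}$, and all $N_{i,j}$ are determined by the $f$-vector together with the values $N_{i,j}$ for $0\le i$, $i+2\le j\le d-2$, as follows: $N_{r,r}=N_{ -1,r}=N_{r,d}=f_r$ for $-1\le r\le d$; $N_{0,1}=2f_1$; for $1\le i\le d-3$, $$N_{i,i+1}=\bigl((-1)^i+1\bigr)f_{i+1}+\sum_{k=0}^{i-1}(-1)^{i+1-k}N_{k,i+1};$$ $N_{d-2,d-1}=2f_{d-2}$; and for $0\le i\le d-3$, $$N_{i,d-1}=\bigl((-1)^{d-i}+1\bigr)f_i+\sum_{j=i+1}^{d-2}(-1)^{d-j}N_{i,j}.$$ In particular, $\mathcal{M}_P(z)$ is determined by the $f$-vector and the numbers $N_{i,j}$ with $0<i+1<j<d-1$.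
   Context: A ranked poset is a finite poset with a rank function $|\cdot|$ such that covering relations increase rank by one and minimal elements have rank $-1$; $f_r$ is the number of elements of rank $r$. The Möbius function is $\mu[p,p]=1$, $\mu[p,q]=-\sum_{p\le s<q}\mu[p,s]$ for $p<q$, $0$ if $p\not\le q$. An Eulerian poset is a ranked poset with unique minimum and maximum elements such that $\mu[p,q]=(-1)^{|q|-|p|}$ for all $p\le q$. For $-1\le i\le j\le d$, $N_{i,j}$ is the number of pairs $(p,q)$ with $p\le q$, $|p|=i$, $|q|=j$. The Möbius polynomial is $\mathcal{M}_P(z)=\sum_{p\le q\in P}\mu[p,q]z^{|q|-|p|}$. -}

module Defs where

open import Data.Fin using (Fin)
import Data.Fin.Induction as Fin
open import Data.Integer using (ℤ; +_; -_; _+_; _-_; _*_; _^_; ∣_∣; 0ℤ; 1ℤ; -1ℤ)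
  renaming (_⊔_ to _⊔ℤ_)
import Data.Integer.Properties as ℤ
open import Data.List using (List; []; _∷_; allFin; cartesianProduct; filter; foldr; length; map; upTo)
open import Data.Nat using (ℕ; zero; suc)
open import Data.Product using (_×_; _,_; proj₁; proj₂)
open import Function using (_on_)
open import Function.Bundles using (Inverse)
open import Induction.WellFounded using (Acc; acc; WellFounded; module Subrelation)
open import Level using (Level; _⊔_; 0ℓ) renaming (suc to lsuc)
open import Relation.Binary using (Rel; Decidable; DecPoset)
import Relation.Binary.Construct.NonStrictToStrict as ToStrict
import Relation.Binary.Construct.On as On
open import Relation.Binary.Definitions using (Minimum; Maximum)
import Relation.Binary.Properties.Poset as PosetProperties
open import Relation.Binary.PropositionalEquality as ≡ using (_≡_)
open import Relation.Nullary using (¬_; yes; no)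
open import Relation.Nullary.Decidable using (_×-dec_)

private
  variable
    a : Level
    A : Set a

-- The integers k with i ≤ k ≤ j, in increasing order; empty when j < i.
[_⋯_] : ℤ → ℤ → List ℤ
[ i ⋯ j ] = map (λ n → i + + n) (upTo ∣ (j - i + 1ℤ) ⊔ℤ 0ℤ ∣)

∑ : List A → (A → ℤ) → ℤ
∑ xs g = foldr (λ x s → g x + s) 0ℤ xs

infix 5 ∑
syntax ∑ xs (λ x → e) = ∑[ x ∈ xs ] e

-- The absolute value loses nothing: (-1)ⁿ depends only on the parity of n.
[-1]^_ : ℤ → ℤ
[-1]^ n = -1ℤ ^ ∣ n ∣

infix 9 [-1]^_

-- ℤ[z], as coefficient lists with the constant term first.  Trailing zeros
-- are allowed, so equality of polynomials is _≈ᴾ_ rather than _≡_.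
Poly : Set
Poly = List ℤ

coeff : Poly → ℕ → ℤ
coeff []      _       = 0ℤ
coeff (c ∷ p) zero    = c
coeff (c ∷ p) (suc k) = coeff p k

infix 4 _≈ᴾ_

_≈ᴾ_ : Rel Poly 0ℓ
p ≈ᴾ q = ∀ k → coeff p k ≡ coeff q k

infixl 6 _+ᴾ_
infixl 7 _*ᴾ_ _·ᴾ_
infixr 8 _^ᴾ_
infix  8 -ᴾ_

_+ᴾ_ : Poly → Poly → Poly
[]      +ᴾ q       = q
(c ∷ p) +ᴾ []      = c ∷ p
(c ∷ p) +ᴾ (e ∷ q) = c + e ∷ p +ᴾ q

_·ᴾ_ : ℤ → Poly → Poly
c ·ᴾ p = map (c *_) p

-ᴾ_ : Poly → Poly
-ᴾ p = map -_ p

_*ᴾ_ : Poly → Poly → Poly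
[]      *ᴾ q = []
(c ∷ p) *ᴾ q = c ·ᴾ q +ᴾ (0ℤ ∷ p *ᴾ q)

_^ᴾ_ : Poly → ℕ → Poly
p ^ᴾ zero  = 1ℤ ∷ []
p ^ᴾ suc n = p *ᴾ p ^ᴾ n

𝑧 : Poly
𝑧 = 0ℤ ∷ 1ℤ ∷ []

∑ᴾ : List A → (A → Poly) → Poly
∑ᴾ xs g = foldr (λ x s → g x +ᴾ s) [] xs

infix 5 ∑ᴾ
syntax ∑ᴾ xs (λ x → e) = ∑ᴾ[ x ∈ xs ] e

record FinitePoset c ℓ₁ ℓ₂ : Set (lsuc (c ⊔ ℓ₁ ⊔ ℓ₂)) where
  field
    decPoset : DecPoset c ℓ₁ ℓ₂

  open DecPoset decPoset public
  open PosetProperties poset public using (_<_)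

  field
    size        : ℕ
    enumeration : Inverse (≡.setoid (Fin size)) Eq.setoid

  module Enum = Inverse enumeration

  elements : List Carrier
  elements = map Enum.to (allFin size)

  infix 4 _<?_ _⋖_

  _<?_ : Decidable _<_
  _<?_ = ToStrict.<-decidable _≈_ _≤_ _≟_ _≤?_

  <-wellFounded : WellFounded _<_
  <-wellFounded = Subrelation.wellFounded transport
    (On.wellFounded Enum.from
      (Fin.po-wellFounded (On.isPartialOrder Enum.to isPartialOrder)))
    where
    transport : ∀ {x y} → x < y → (_<_ on (λ x → Enum.to (Enum.from x))) x y
    transport {x} {y} x<y =
      PosetProperties.<-respˡ-≈ poset (Eq.sym (Enum.strictlyInverseˡ x))
        (PosetProperties.<-respʳ-≈ poset (Eq.sym (Enum.strictlyInverseˡ y)) x<y)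

  _⋖_ : Rel Carrier _
  p ⋖ q = p < q × (∀ s → ¬ (p < s × s < q))

  Minimal : Carrier → Set _
  Minimal p = ∀ s → ¬ (s < p)

  mutual
    μ′ : ∀ p q → Acc _<_ q → ℤ
    μ′ p q (acc below) with p ≟ q | p ≤? q
    ... | yes _ | _     = 1ℤ
    ... | no  _ | no  _ = 0ℤ
    ... | no  _ | yes _ = - (∑[ s ∈ elements ] μ′-summand p q below s)

    μ′-summand : ∀ p q → (∀ {s} → s < q → Acc _<_ s) → Carrier → ℤ
    μ′-summand p q below s with p ≤? s | s <? q
    ... | yes _ | yes s<q = μ′ p s (below s<q)
    ... | _     | _       = 0ℤ

  μ[_,_] : Carrier → Carrier → ℤ
  μ[ p , q ] = μ′ p q (<-wellFounded q)

  intervals : List (Carrier × Carrier)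
  intervals = filter (λ (p , q) → p ≤? q) (cartesianProduct elements elements)

record RankedPoset c ℓ₁ ℓ₂ : Set (lsuc (c ⊔ ℓ₁ ⊔ ℓ₂)) where
  field
    finitePoset : FinitePoset c ℓ₁ ℓ₂

  open FinitePoset finitePoset public

  field
    rank         : Carrier → ℤ
    rank-cong    : ∀ {p q} → p ≈ q → rank p ≡ rank q
    rank-cover   : ∀ {p q} → p ⋖ q → rank q ≡ rank p + 1ℤ
    rank-minimal : ∀ {p} → Minimal p → rank p ≡ -1ℤ

  f : ℤ → ℕ
  f r = length (filter (λ p → rank p ℤ.≟ r) elements)

  N : ℤ → ℤ → ℕ
  N i j = length (filter (λ (p , q) → (rank p ℤ.≟ i) ×-dec (rank q ℤ.≟ j)) intervals)

  -- On intervals |q| − |p| ≥ 0, so ∣_∣ only converts the exponent to ℕ.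
  möbiusPolynomial : Poly
  möbiusPolynomial =
    ∑ᴾ[ I ∈ intervals ]
      (μ[ proj₁ I , proj₂ I ] ·ᴾ 𝑧 ^ᴾ ∣ rank (proj₂ I) - rank (proj₁ I) ∣)

-- The rank of the poset is the rank of its maximum element.
record EulerianPoset c ℓ₁ ℓ₂ (d : ℤ) : Set (lsuc (c ⊔ ℓ₁ ⊔ ℓ₂)) where
  field
    rankedPoset : RankedPoset c ℓ₁ ℓ₂

  open RankedPoset rankedPoset public

  field
    0̂ 1̂      : Carrier
    minimum  : Minimum _≤_ 0̂
    maximum  : Maximum _≤_ 1̂
    rank-1̂   : rank 1̂ ≡ d
    eulerian : ∀ {p q} → p ≤ q → μ[ p , q ] ≡ [-1]^ (rank q - rank p)

{-# OPTIONS --safe #-}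

-- Since μ[p,s] = (-1)^{|s|-|p|}, the recursion for μ says that
-- ∑_{p≤s≤q} (-1)^{|s|-|p|} = 0 whenever p < q.  Summing this over the intervals
-- [0̂,q] with |q| = j, and over the intervals [p,1̂] with |p| = i, gives
--   ∑_{-1≤k≤j} (-1)^{j-k} N_{k,j} = 0   and   ∑_{i≤k≤d} (-1)^{d-k} N_{i,k} = 0.
-- The first relation is solved for N_{j-1,j}, the second for N_{i,d-1}.
module Submission where

open import Defs
open import Data.Integer using (ℤ; +_; _+_; _-_; _*_; _≤_; _<_; ∣_∣; 0ℤ; 1ℤ; -1ℤ)
open import Data.Nat using (ℕ)
open import Data.Product using (_×_)
open import Relation.Binary.PropositionalEquality using (_≡_)
open EulerianPoset using (f; N; möbiusPolynomial)
open import Data.Integer.Properties using (+-0-abelianGroup)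
open import Algebra.Properties.AbelianGroup +-0-abelianGroup using (∙-cancelˡ)
import Data.Fin.Induction as Fin
import Data.Fin.Properties as Fin
open import Data.Integer using (-[1+_]; -_; _^_; _⊔_; +≤+; +<+; -≤+; -<+; -≤-; -<-)
import Data.Integer.Properties as ℤ
open import Data.Integer.Tactic.RingSolver using (solve-∀)
open import Data.List
  using (List; []; _∷_; _++_; allFin; applyUpTo; cartesianProduct; filter; length; map; upTo)
open import Data.List.Properties using (applyUpTo-∷ʳ; map-upTo)
open import Data.List.Membership.Propositional using (_∈_)
open import Data.List.Membership.Propositional.Properties
  using (∈-allFin; ∈-filter⁻; ∈-map⁺; ∈-map⁻; ∈-upTo⁺; ∈-upTo⁻)
open import Data.List.Relation.Unary.All as All using (All; []; _∷_)
import Data.List.Relation.Unary.All.Properties as All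
open import Data.List.Relation.Unary.AllPairs as AllPairs using (AllPairs; []; _∷_)
open import Data.List.Relation.Unary.Any as Any using (Any; here; there)
import Data.List.Relation.Unary.Any.Properties as Any
import Data.List.Relation.Unary.Unique.Propositional.Properties as Unique
import Data.List.Relation.Unary.AllPairs.Properties as AllPairs
open import Data.Nat using (zero; suc)
import Data.Nat as ℕ
import Data.Nat.Properties as ℕ
open import Data.Product using (∃; _,_; proj₁; proj₂)
open import Data.Sum using (_⊎_; inj₁; inj₂)
open import Function using (_∘_; flip)
open import Induction.WellFounded using (Acc; acc; WellFounded; module Subrelation)
open import Level using (Level)
import Relation.Binary.Construct.On as On
import Relation.Binary.Properties.Poset as PosetProperties
open import Relation.Binary.PropositionalEquality
  using (_≢_; refl; sym; trans; cong; cong₂; subst; module ≡-Reasoning)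
open import Relation.Nullary using (¬_; Dec; yes; no; contradiction)
open import Relation.Nullary.Decidable using (_×-dec_)
open import Relation.Unary using (Pred; Decidable)

open ≡-Reasoning

private
  variable
    a b p : Level
    A : Set a
    B : Set b

-- Determination involves no circularity. For i + 1 ≤ d - 2 the formula for N_{i,i+1} mentions only
-- the f-vector and N_{k,i+1} with k ≤ i - 1, and these are prescribed values. After that all
-- N_{i,j} with 0 ≤ i < j ≤ d - 2 are known, and the formula for N_{i,d-1} mentions nothing else
-- beyond the f-vector. A ranked poset gives it only on covering pairs, so it has to be extended to
-- all strict pairs first. Every count is expanded into a finite sum of indicators `χ`. Regrouping
-- intervals by the ranks of their ends is then an exchange of sums, and a fact that holds only for
-- some intervals is applied under the indicator that selects them. The same regrouping, with
-- coefficients of powers of -z in place of signs, yields the formula for the Möbius polynomial.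

+-congˡ : ∀ i {j k} → j ≡ k → i + j ≡ i + k
+-congˡ i = cong (λ k → i + k)

-- Finite sums

∑-cong∈ : ∀ (xs : List A) {g h : A → ℤ} → (∀ {x} → x ∈ xs → g x ≡ h x) → ∑ xs g ≡ ∑ xs h
∑-cong∈ []       g≗h = refl
∑-cong∈ (x ∷ xs) g≗h = cong₂ _+_ (g≗h (here refl)) (∑-cong∈ xs (g≗h ∘ there))

∑-cong : ∀ (xs : List A) {g h : A → ℤ} → (∀ x → g x ≡ h x) → ∑ xs g ≡ ∑ xs h
∑-cong xs g≗h = ∑-cong∈ xs (λ {x} _ → g≗h x)

∑-zero : ∀ (xs : List A) {g : A → ℤ} → All (λ x → g x ≡ 0ℤ) xs → ∑ xs g ≡ 0ℤ
∑-zero []       []       = refl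
∑-zero (x ∷ xs) (e ∷ es) = cong₂ _+_ e (∑-zero xs es)

∑-+ : ∀ (xs : List A) (g h : A → ℤ) → (∑[ x ∈ xs ] g x + h x) ≡ ∑ xs g + ∑ xs h
∑-+ []       g h = refl
∑-+ (x ∷ xs) g h = trans (+-congˡ (g x + h x) (∑-+ xs g h)) (interchange (g x) (h x) (∑ xs g) (∑ xs h))
  where
  interchange : ∀ i j k l → i + j + (k + l) ≡ i + k + (j + l)
  interchange = solve-∀

∑-*ˡ : ∀ (xs : List A) c (g : A → ℤ) → (∑[ x ∈ xs ] c * g x) ≡ c * ∑ xs g
∑-*ˡ []       c g = sym (ℤ.*-zeroʳ c)
∑-*ˡ (x ∷ xs) c g = trans (+-congˡ (c * g x) (∑-*ˡ xs c g)) (sym (ℤ.*-distribˡ-+ c (g x) (∑ xs g)))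

∑-swap : ∀ (xs : List A) (ys : List B) (g : A → B → ℤ) →
         (∑[ x ∈ xs ] ∑[ y ∈ ys ] g x y) ≡ (∑[ y ∈ ys ] ∑[ x ∈ xs ] g x y)
∑-swap []       ys g = sym (∑-zero ys (All.universal (λ _ → refl) ys))
∑-swap (x ∷ xs) ys g = trans (+-congˡ (∑ ys (g x)) (∑-swap xs ys g)) (sym (∑-+ ys (g x) (λ y → ∑[ x ∈ xs ] g x y)))

∑-++ : ∀ (xs ys : List A) (g : A → ℤ) → ∑ (xs ++ ys) g ≡ ∑ xs g + ∑ ys g
∑-++ []       ys g = sym (ℤ.+-identityˡ _)
∑-++ (x ∷ xs) ys g = trans (+-congˡ (g x) (∑-++ xs ys g)) (sym (ℤ.+-assoc (g x) (∑ xs g) (∑ ys g)))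

∑-map : ∀ (h : A → B) (xs : List A) (g : B → ℤ) → ∑ (map h xs) g ≡ ∑ xs (g ∘ h)
∑-map h []       g = refl
∑-map h (x ∷ xs) g = +-congˡ (g (h x)) (∑-map h xs g)

∑-cartesianProduct : ∀ (xs : List A) (ys : List B) (g : A × B → ℤ) →
                     ∑ (cartesianProduct xs ys) g ≡ (∑[ x ∈ xs ] ∑[ y ∈ ys ] g (x , y))
∑-cartesianProduct []       ys g = refl
∑-cartesianProduct (x ∷ xs) ys g =
  trans (∑-++ (map (x ,_) ys) _ g)
        (cong₂ _+_ (∑-map (x ,_) ys g) (∑-cartesianProduct xs ys g))

-- Uniqueness is phrased as pairwise exclusion of `P`, so that one lemma serves integer ranges,
-- where `P` is equality, and `elements`, where `P` is `_≈_` with a fixed element.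
∑-single : ∀ {P : Pred A p} {xs : List A} {g : A → ℤ} {c} →
           Any P xs → AllPairs (λ x y → P x → ¬ P y) xs →
           (∀ x → P x → g x ≡ c) → (∀ x → ¬ P x → g x ≡ 0ℤ) → ∑ xs g ≡ c
∑-single {xs = x ∷ xs} (here px) (px⇒¬ ∷ _) hit miss =
  trans (cong₂ _+_ (hit x px) (∑-zero xs (All.map (λ ¬p → miss _ (¬p px)) px⇒¬))) (ℤ.+-identityʳ _)
∑-single {xs = x ∷ xs} (there any) (px⇒¬ ∷ pairs) hit miss =
  trans (cong₂ _+_ (miss x (λ px → All.All¬⇒¬Any (All.map (λ ¬p → ¬p px) px⇒¬) any))
                   (∑-single any pairs hit miss))
        (ℤ.+-identityˡ _)

-- Indicators

χ : Dec A → ℤ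
χ (yes _) = 1ℤ
χ (no  _) = 0ℤ

χ-true : (A? : Dec A) → A → χ A? ≡ 1ℤ
χ-true (yes _) _ = refl
χ-true (no ¬a) a = contradiction a ¬a

χ-false : (A? : Dec A) → ¬ A → χ A? ≡ 0ℤ
χ-false (yes a) ¬a = contradiction a ¬a
χ-false (no  _) _  = refl

χ-⇔ : (A? : Dec A) (B? : Dec B) → (A → B) → (B → A) → χ A? ≡ χ B?
χ-⇔ (yes a) B? to from = sym (χ-true B? (to a))
χ-⇔ (no ¬a) B? to from = sym (χ-false B? (¬a ∘ from))

χ-× : (A? : Dec A) (B? : Dec B) → χ (A? ×-dec B?) ≡ χ A? * χ B?
χ-× (yes _) (yes _) = refl
χ-× (yes _) (no  _) = refl
χ-× (no  _) (yes _) = refl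
χ-× (no  _) (no  _) = refl

-- Conditional rewriting inside a sum: the indicator supplies the hypothesis under which the
-- equation holds.
χ-*-cong : (A? : Dec A) {x y : ℤ} → (A → x ≡ y) → χ A? * x ≡ χ A? * y
χ-*-cong (yes a) x≡y = cong (1ℤ *_) (x≡y a)
χ-*-cong (no  _) x≡y = refl

∑-filter : ∀ {P : Pred A p} (P? : Decidable P) xs (g : A → ℤ) →
           ∑ (filter P? xs) g ≡ (∑[ x ∈ xs ] χ (P? x) * g x)
∑-filter P? []       g = refl
∑-filter P? (x ∷ xs) g with P? x
... | yes _ = cong₂ _+_ (sym (ℤ.*-identityˡ (g x))) (∑-filter P? xs g)
... | no  _ = trans (∑-filter P? xs g) (sym (ℤ.+-identityˡ _))

length-filter : ∀ {P : Pred A p} (P? : Decidable P) xs → + length (filter P? xs) ≡ (∑[ x ∈ xs ] χ (P? x))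
length-filter P? []       = refl
length-filter P? (x ∷ xs) with P? x
... | yes _ = +-congˡ 1ℤ (length-filter P? xs)
... | no  _ = trans (length-filter P? xs) (sym (ℤ.+-identityˡ _))

-- Integer intervals

-- Linear inequalities are transported along an identity between differences,
-- which the ring solver proves.
≤-by : ∀ {i j k l} → j - i ≡ l - k → i ≤ j → k ≤ l
≤-by e i≤j = ℤ.0≤i-j⇒j≤i (subst (0ℤ ≤_) e (ℤ.i≤j⇒0≤j-i i≤j))

≤⇒∃ : ∀ {i j} → i ≤ j → ∃ λ n → j ≡ i + + n
≤⇒∃ {i} {j} i≤j = ∣ j - i ∣ , sym (trans (cong (λ k → i + k) (ℤ.0≤i⇒+∣i∣≡i (ℤ.i≤j⇒0≤j-i i≤j))) (cancel i j))
  where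
  cancel : ∀ i j → i + (j - i) ≡ j
  cancel = solve-∀

⋯-unique : ∀ i j → AllPairs _≢_ [ i ⋯ j ]
⋯-unique i j = Unique.map⁺ (λ {m} {n} e → ℤ.+-injective (∙-cancelˡ i (+ m) (+ n) e)) (Unique.upTo⁺ _)

∈-⋯⁺ : ∀ {i j k} → i ≤ k → k ≤ j → k ∈ [ i ⋯ j ]
∈-⋯⁺ {i} {j} {k} i≤k k≤j with m , refl ← ≤⇒∃ i≤k with n , refl ← ≤⇒∃ k≤j =
  ∈-map⁺ (λ n → i + + n) (∈-upTo⁺ (subst (m ℕ.<_) (sym len) (ℕ.s≤s (ℕ.m≤m+n m n))))
  where
  diff : ∀ i m n → i + m + n - i + 1ℤ ≡ 1ℤ + (m + n)
  diff = solve-∀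
  len : ∣ (i + + m + + n - i + 1ℤ) ⊔ 0ℤ ∣ ≡ suc (m ℕ.+ n)
  len = cong (λ l → ∣ l ⊔ 0ℤ ∣) (diff i (+ m) (+ n))

∈-⋯⁻ : ∀ i j {k} → k ∈ [ i ⋯ j ] → i ≤ k × k ≤ j
∈-⋯⁻ i j k∈ with n , n∈ , refl ← ∈-map⁻ (λ n → i + + n) k∈ =
  ℤ.i≤i+j i (+ n) , bound (j - i + 1ℤ) refl (∈-upTo⁻ n∈)
  where
  shift : ∀ i j n → j - i + 1ℤ - (1ℤ + n) ≡ j - (i + n)
  shift = solve-∀
  -- The length is abstracted to `l` so that its sign can be inspected; a negative `l` means an
  -- empty range, without members.
  bound : ∀ l → j - i + 1ℤ ≡ l → n ℕ.< ∣ l ⊔ 0ℤ ∣ → i + + n ≤ j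
  bound (+ m)    e n<m = ≤-by (trans (cong (_- + suc n) (sym e)) (shift i j (+ n)))
                              (+≤+ (subst (n ℕ.<_) (ℕ.⊔-identityʳ m) n<m))
  bound -[1+ m ] e ()

-- Once the length is a natural number, the range unfolds by recursion on it. The case `n = 0`
-- covers j = i - 1, the empty range left after the last term is split off.
⋯-applyUpTo : ∀ i j n → j - i + 1ℤ ≡ + n → [ i ⋯ j ] ≡ applyUpTo (λ k → i + + k) n
⋯-applyUpTo i j n e =
  trans (cong (map _ ∘ upTo) (trans (cong (λ l → ∣ l ⊔ 0ℤ ∣) e) (ℕ.⊔-identityʳ n))) (map-upTo _ n)

∑-applyUpTo-cong : ∀ {g h : ℕ → ℤ} n (F : ℤ → ℤ) → (∀ k → g k ≡ h k) →
                   ∑ (applyUpTo g n) F ≡ ∑ (applyUpTo h n) F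
∑-applyUpTo-cong zero    F g≗h = refl
∑-applyUpTo-cong (suc n) F g≗h = cong₂ _+_ (cong F (g≗h 0)) (∑-applyUpTo-cong n F (g≗h ∘ suc))

∑-⋯-cons : ∀ {i j} → i ≤ j → (F : ℤ → ℤ) → ∑ [ i ⋯ j ] F ≡ F i + ∑ [ i + 1ℤ ⋯ j ] F
∑-⋯-cons {i} i≤j F with n , refl ← ≤⇒∃ i≤j =
  trans (cong (λ l → ∑ l F) (⋯-applyUpTo i (i + + n) (suc n) (len i (+ n))))
  (cong₂ _+_ (cong F (ℤ.+-identityʳ i))
  (trans (∑-applyUpTo-cong n F (λ k → step i (+ k)))
         (cong (λ l → ∑ l F) (sym (⋯-applyUpTo (i + 1ℤ) (i + + n) n (len′ i (+ n)))))))
  where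
  len : ∀ i n → i + n - i + 1ℤ ≡ 1ℤ + n
  len = solve-∀
  len′ : ∀ i n → i + n - (i + 1ℤ) + 1ℤ ≡ n
  len′ = solve-∀
  step : ∀ i k → i + (1ℤ + k) ≡ i + 1ℤ + k
  step = solve-∀

∑-⋯-snoc : ∀ {i j} → i ≤ j → (F : ℤ → ℤ) → ∑ [ i ⋯ j ] F ≡ ∑ [ i ⋯ j - 1ℤ ] F + F j
∑-⋯-snoc {i} i≤j F with n , refl ← ≤⇒∃ i≤j =
  trans (cong (λ l → ∑ l F) (trans (⋯-applyUpTo i (i + + n) (suc n) (len i (+ n))) (sym (applyUpTo-∷ʳ (λ k → i + + k) n))))
  (trans (∑-++ (applyUpTo (λ k → i + + k) n) (i + + n ∷ []) F)
         (cong₂ _+_ (cong (λ l → ∑ l F) (sym (⋯-applyUpTo i (i + + n - 1ℤ) n (len′ i (+ n))))) (ℤ.+-identityʳ (F (i + + n)))))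
  where
  len : ∀ i n → i + n - i + 1ℤ ≡ 1ℤ + n
  len = solve-∀
  len′ : ∀ i n → i + n - 1ℤ - i + 1ℤ ≡ n
  len′ = solve-∀

∑-⋯-χ : ∀ {i j k} → i ≤ k → k ≤ j → (F : ℤ → ℤ) → (∑[ l ∈ [ i ⋯ j ] ] χ (k ℤ.≟ l) * F l) ≡ F k
∑-⋯-χ {i} {j} {k} i≤k k≤j F =
  ∑-single (∈-⋯⁺ i≤k k≤j) (AllPairs.map (λ { l≢m refl refl → l≢m refl }) (⋯-unique i j))
    (λ { l refl → trans (cong (_* F k) (χ-true (k ℤ.≟ k) refl)) (ℤ.*-identityˡ _) })
    (λ l k≢l → cong (_* F l) (χ-false (k ℤ.≟ l) k≢l))

-- Parity

[-1]^-suc : ∀ i → [-1]^ (i + 1ℤ) ≡ -1ℤ * [-1]^ i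
[-1]^-suc (+ n)          = cong (-1ℤ ^_) (ℕ.+-comm n 1)
[-1]^-suc -[1+ zero  ]   = refl
-- Here adding one lowers the absolute value, so the exponents on the two sides differ by 2 and a
-- square of -1 cancels.
[-1]^-suc -[1+ suc n ]   = double (-1ℤ ^ n)
  where
  double : ∀ x → -1ℤ * x ≡ -1ℤ * (-1ℤ * (-1ℤ * x))
  double = solve-∀

[-1]^-+-ℕ : ∀ i n → [-1]^ (i + + n) ≡ [-1]^ i * -1ℤ ^ n
[-1]^-+-ℕ i zero    = trans (cong [-1]^_ (ℤ.+-identityʳ i)) (sym (ℤ.*-identityʳ _))
[-1]^-+-ℕ i (suc n) = begin
  [-1]^ (i + + suc n)        ≡⟨ cong [-1]^_ (assoc i (+ n)) ⟩
  [-1]^ (i + + n + 1ℤ)       ≡⟨ [-1]^-suc (i + + n) ⟩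
  -1ℤ * [-1]^ (i + + n)      ≡⟨ cong (-1ℤ *_) ([-1]^-+-ℕ i n) ⟩
  -1ℤ * ([-1]^ i * -1ℤ ^ n)  ≡⟨ pull ([-1]^ i) (-1ℤ ^ n) ⟩
  [-1]^ i * -1ℤ ^ suc n      ∎
  where
  assoc : ∀ i n → i + (1ℤ + n) ≡ i + n + 1ℤ
  assoc = solve-∀
  pull : ∀ x y → -1ℤ * (x * y) ≡ x * (-1ℤ * y)
  pull = solve-∀

-1^-square : ∀ n → -1ℤ ^ n * -1ℤ ^ n ≡ 1ℤ
-1^-square zero    = refl
-1^-square (suc n) = trans (double (-1ℤ ^ n)) (-1^-square n)
  where
  double : ∀ x → -1ℤ * x * (-1ℤ * x) ≡ x * x
  double = solve-∀

[-1]^-+ : ∀ i j → [-1]^ (i + j) ≡ [-1]^ i * [-1]^ j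
[-1]^-+ i (+ n)    = [-1]^-+-ℕ i n
-- The square of `-1ℤ ^ m` is inserted as a factor 1; absorbing one copy of it adds `m` back to the
-- exponent and removes the negative summand.
[-1]^-+ i -[1+ n ] = begin
  [-1]^ (i + j)                          ≡⟨ ℤ.*-identityʳ _ ⟨
  [-1]^ (i + j) * 1ℤ                     ≡⟨ cong ([-1]^ (i + j) *_) (-1^-square m) ⟨
  [-1]^ (i + j) * (-1ℤ ^ m * -1ℤ ^ m)    ≡⟨ ℤ.*-assoc ([-1]^ (i + j)) _ _ ⟨
  [-1]^ (i + j) * -1ℤ ^ m * -1ℤ ^ m      ≡⟨ cong (_* -1ℤ ^ m) ([-1]^-+-ℕ (i + j) m) ⟨
  [-1]^ (i + j + + m) * -1ℤ ^ m          ≡⟨ cong (λ k → [-1]^ k * -1ℤ ^ m) (cancel i (+ m)) ⟩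
  [-1]^ i * -1ℤ ^ m                      ∎
  where
  m = suc n
  j = -[1+ n ]
  cancel : ∀ i n → i - n + n ≡ i
  cancel = solve-∀

[-1]^-neg : ∀ i → [-1]^ (- i) ≡ [-1]^ i
[-1]^-neg i = cong (-1ℤ ^_) (ℤ.∣-i∣≡∣i∣ i)

-- A sign is its own inverse, so a difference of exponents becomes a product. This separates a sign
-- that is constant along a sum from the sign in the Euler relation.
[-1]^-difference : ∀ i j k → [-1]^ (k - j) ≡ [-1]^ (k - i) * [-1]^ (j - i)
[-1]^-difference i j k = begin
  [-1]^ (k - j)                      ≡⟨ cong [-1]^_ (split i j k) ⟩
  [-1]^ (k - i + - (j - i))          ≡⟨ [-1]^-+ (k - i) (- (j - i)) ⟩
  [-1]^ (k - i) * [-1]^ (- (j - i))  ≡⟨ cong ([-1]^ (k - i) *_) ([-1]^-neg (j - i)) ⟩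
  [-1]^ (k - i) * [-1]^ (j - i)      ∎
  where
  split : ∀ i j k → k - j ≡ k - i + - (j - i)
  split = solve-∀

-- Polynomials

coeff-+ᴾ : ∀ P Q k → coeff (P +ᴾ Q) k ≡ coeff P k + coeff Q k
coeff-+ᴾ []      Q       k       = sym (ℤ.+-identityˡ _)
coeff-+ᴾ (c ∷ P) []      k       = sym (ℤ.+-identityʳ _)
coeff-+ᴾ (c ∷ P) (e ∷ Q) zero    = refl
coeff-+ᴾ (c ∷ P) (e ∷ Q) (suc k) = coeff-+ᴾ P Q k

coeff-·ᴾ : ∀ c P k → coeff (c ·ᴾ P) k ≡ c * coeff P k
coeff-·ᴾ c []      k       = sym (ℤ.*-zeroʳ c)
coeff-·ᴾ c (e ∷ P) zero    = refl
coeff-·ᴾ c (e ∷ P) (suc k) = coeff-·ᴾ c P k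

coeff-∑ᴾ : ∀ (xs : List A) (g : A → Poly) k → coeff (∑ᴾ xs g) k ≡ (∑[ x ∈ xs ] coeff (g x) k)
coeff-∑ᴾ []       g k = refl
coeff-∑ᴾ (x ∷ xs) g k = trans (coeff-+ᴾ (g x) _ k) (+-congˡ (coeff (g x) k) (coeff-∑ᴾ xs g k))

coeff-linear-*-zero : ∀ c P → coeff ((0ℤ ∷ c ∷ []) *ᴾ P) zero ≡ 0ℤ
coeff-linear-*-zero c P = trans (coeff-+ᴾ (0ℤ ·ᴾ P) _ zero) (cong (_+ 0ℤ) (coeff-·ᴾ 0ℤ P zero))

coeff-linear-*-suc : ∀ c P k → coeff ((0ℤ ∷ c ∷ []) *ᴾ P) (suc k) ≡ c * coeff P k
coeff-linear-*-suc c P k = begin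
  coeff (0ℤ ·ᴾ P +ᴾ (0ℤ ∷ (c ·ᴾ P +ᴾ (0ℤ ∷ [])))) (suc k)
    ≡⟨ coeff-+ᴾ (0ℤ ·ᴾ P) _ (suc k) ⟩
  coeff (0ℤ ·ᴾ P) (suc k) + coeff (c ·ᴾ P +ᴾ (0ℤ ∷ [])) k
    ≡⟨ cong₂ _+_ (coeff-·ᴾ 0ℤ P (suc k)) (coeff-+ᴾ (c ·ᴾ P) _ k) ⟩
  0ℤ + (coeff (c ·ᴾ P) k + coeff (0ℤ ∷ []) k)
    -- The product leaves a trailing zero coefficient, which is harmless because only coefficients
    -- are compared.
    ≡⟨ cong (λ x → 0ℤ + (coeff (c ·ᴾ P) k + x)) (coeff-zero k) ⟩
  0ℤ + (coeff (c ·ᴾ P) k + 0ℤ)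
    ≡⟨ trans (ℤ.+-identityˡ _) (ℤ.+-identityʳ _) ⟩
  coeff (c ·ᴾ P) k
    ≡⟨ coeff-·ᴾ c P k ⟩
  c * coeff P k
    ∎
  where
  coeff-zero : ∀ k → coeff (0ℤ ∷ []) k ≡ 0ℤ
  coeff-zero zero    = refl
  coeff-zero (suc k) = refl

-- This is (cz)^n = c^n z^n. At c = -1 the linear polynomial is what `-ᴾ 𝑧` reduces to, so the
-- Möbius sign is absorbed into a power of -z.
coeff-linear-^ : ∀ c n k → coeff ((0ℤ ∷ c ∷ []) ^ᴾ n) k ≡ c ^ n * coeff (𝑧 ^ᴾ n) k
coeff-linear-^ c zero    k       = sym (ℤ.*-identityˡ _)
coeff-linear-^ c (suc n) zero    =
  trans (coeff-linear-*-zero c ((0ℤ ∷ c ∷ []) ^ᴾ n))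
        (sym (trans (cong (c ^ suc n *_) (coeff-linear-*-zero 1ℤ (𝑧 ^ᴾ n))) (ℤ.*-zeroʳ (c ^ suc n))))
coeff-linear-^ c (suc n) (suc k) = begin
  coeff ((0ℤ ∷ c ∷ []) ^ᴾ suc n) (suc k)    ≡⟨ coeff-linear-*-suc c ((0ℤ ∷ c ∷ []) ^ᴾ n) k ⟩
  c * coeff ((0ℤ ∷ c ∷ []) ^ᴾ n) k          ≡⟨ cong (c *_) (coeff-linear-^ c n k) ⟩
  c * (c ^ n * coeff (𝑧 ^ᴾ n) k)            ≡⟨ ℤ.*-assoc c (c ^ n) _ ⟨
  c ^ suc n * coeff (𝑧 ^ᴾ n) k              ≡⟨ cong (c ^ suc n *_) (trans (coeff-linear-*-suc 1ℤ (𝑧 ^ᴾ n) k) (ℤ.*-identityˡ (coeff (𝑧 ^ᴾ n) k))) ⟨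
  c ^ suc n * coeff (𝑧 ^ᴾ suc n) (suc k)    ∎

-- Finite posets

module FinitePosetProperties {c ℓ₁ ℓ₂} (F : FinitePoset c ℓ₁ ℓ₂) where
  open FinitePoset F using
    ( Carrier; _≈_; _≟_; isPartialOrder; reflexive; module Eq; poset; size; module Enum
    ; elements; intervals; <-wellFounded; μ′; μ′-summand; μ[_,_])
    renaming (_≤_ to _⊑_; _<_ to _⊏_; _≤?_ to _⊑?_; _<?_ to _⊏?_)
  open PosetProperties poset using (<-respˡ-≈; <-respʳ-≈)

  -- The enumeration meets every `_≈_`-class exactly once: it reaches `y` at `Enum.from y`, and two
  -- indices with equivalent values coincide because `Enum.from` respects `_≈_`.
  ∑-elements : ∀ y {g : Carrier → ℤ} {c} → (∀ x → x ≈ y → g x ≡ c) → (∀ x → ¬ x ≈ y → g x ≡ 0ℤ) →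
               ∑ elements g ≡ c
  ∑-elements y = ∑-single
    (Any.map⁺ (Any.map (λ { refl → Enum.strictlyInverseˡ y }) (∈-allFin (Enum.from y))))
    (AllPairs.map⁺ (AllPairs.map (λ i≢j i≈y j≈y → i≢j (to-injective (Eq.trans i≈y (Eq.sym j≈y))))
                                 (Unique.allFin⁺ size)))
    where
    to-injective : ∀ {i j} → Enum.to i ≈ Enum.to j → i ≡ j
    to-injective {i} {j} e =
      trans (sym (Enum.strictlyInverseʳ i)) (trans (Enum.from-cong e) (Enum.strictlyInverseʳ j))

  ∑-intervals : ∀ (g : Carrier × Carrier → ℤ) →
                ∑ intervals g ≡ (∑[ x ∈ elements ] ∑[ y ∈ elements ] χ (x ⊑? y) * g (x , y))
  ∑-intervals g = trans (∑-filter (λ (x , y) → x ⊑? y) (cartesianProduct elements elements) g)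
                        (∑-cartesianProduct elements elements (λ (x , y) → χ (x ⊑? y) * g (x , y)))

  ∑-intervals-cong : ∀ {g h : Carrier × Carrier → ℤ} → (∀ x y → x ⊑ y → g (x , y) ≡ h (x , y)) →
                     ∑ intervals g ≡ ∑ intervals h
  ∑-intervals-cong g≗h =
    ∑-cong∈ intervals λ I∈ →
      g≗h _ _ (proj₂ (∈-filter⁻ (λ (x , y) → x ⊑? y) {xs = cartesianProduct elements elements} I∈))

  -- Splits off the top of an interval: the recursion for μ runs over `s ⊏ y`, the Euler relation
  -- over `s ⊑ y`.
  χ-⊑ : ∀ x y → χ (x ⊑? y) ≡ χ (x ⊏? y) + χ (x ≟ y)
  χ-⊑ x y = split (x ≟ y)
    where
    split : (x≈?y : Dec (x ≈ y)) → χ (x ⊑? y) ≡ χ (x ⊏? y) + χ x≈?y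
    split (yes x≈y) = trans (χ-true (x ⊑? y) (reflexive x≈y))
                            (sym (cong (_+ 1ℤ) (χ-false (x ⊏? y) (λ x⊏y → proj₂ x⊏y x≈y))))
    split (no  x≉y) = trans (χ-⇔ (x ⊑? y) (x ⊏? y) (_, x≉y) proj₁) (sym (ℤ.+-identityʳ _))

  mutual
    -- The recursion evaluates at `s` with an accessibility proof inherited from `y`, whereas
    -- `μ[ x , s ]` uses the proof `<-wellFounded s`. Independence of this proof turns the recursion
    -- into an equation for μ itself.
    μ′-irrelevant : ∀ x y (a a′ : Acc _⊏_ y) → μ′ x y a ≡ μ′ x y a′
    μ′-irrelevant x y (acc below) (acc below′) with x ≟ y | x ⊑? y
    ... | yes _ | _     = refl
    ... | no  _ | no  _ = refl
    ... | no  _ | yes _ = cong -_ (∑-cong elements (μ′-summand-irrelevant x y below below′))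

    μ′-summand-irrelevant : ∀ x y (below below′ : ∀ {s} → s ⊏ y → Acc _⊏_ s) s →
                            μ′-summand x y below s ≡ μ′-summand x y below′ s
    μ′-summand-irrelevant x y below below′ s with x ⊑? s | s ⊏? y
    ... | yes _ | yes s⊏y = μ′-irrelevant x s (below s⊏y) (below′ s⊏y)
    ... | yes _ | no  _   = refl
    ... | no  _ | _       = refl

  -- The case distinctions of the recursion become indicator factors, so that the rules for sums
  -- apply to it.
  μ-unfold : ∀ {x y} → x ⊏ y →
             μ[ x , y ] ≡ - (∑[ s ∈ elements ] χ (x ⊑? s) * (χ (s ⊏? y) * μ[ x , s ]))
  μ-unfold {x} {y} (x⊑y , x≉y) = unfold (<-wellFounded y)
    where
    summand : ∀ (below : ∀ {s} → s ⊏ y → Acc _⊏_ s) s →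
              μ′-summand x y below s ≡ χ (x ⊑? s) * (χ (s ⊏? y) * μ[ x , s ])
    summand below s with x ⊑? s | s ⊏? y
    ... | yes _ | yes s⊏y = trans (μ′-irrelevant x s (below s⊏y) (<-wellFounded s))
                                  (sym (trans (ℤ.*-identityˡ _) (ℤ.*-identityˡ _)))
    ... | yes _ | no  _   = refl
    ... | no  _ | _       = refl

    unfold : ∀ a → μ′ x y a ≡ - (∑[ s ∈ elements ] χ (x ⊑? s) * (χ (s ⊏? y) * μ[ x , s ]))
    unfold (acc below) with x ≟ y | x ⊑? y
    ... | yes x≈y | _       = contradiction x≈y x≉y
    ... | no  _   | no  x⋢y = contradiction x⊑y x⋢y
    ... | no  _   | yes _   = cong -_ (∑-cong elements (summand below))

  >-wellFounded : WellFounded (flip _⊏_)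
  >-wellFounded = Subrelation.wellFounded transport
    (On.wellFounded Enum.from (Fin.po-noetherian (On.isPartialOrder Enum.to isPartialOrder)))
    where
    transport : ∀ {x y} → y ⊏ x → Enum.to (Enum.from y) ⊏ Enum.to (Enum.from x)
    transport {x} {y} y⊏x =
      <-respˡ-≈ (Eq.sym (Enum.strictlyInverseˡ y)) (<-respʳ-≈ (Eq.sym (Enum.strictlyInverseˡ x)) y⊏x)

  -- The negative answer is exactly the second component of `_⋖_`: a strict pair either splits or is
  -- a cover. Finiteness makes the search possible.
  between? : ∀ x y → (∃ λ s → x ⊏ s × s ⊏ y) ⊎ (∀ s → ¬ (x ⊏ s × s ⊏ y))
  between? x y with Fin.any? (λ i → (x ⊏? Enum.to i) ×-dec (Enum.to i ⊏? y))
  ... | yes (i , x⊏s⊏y) = inj₁ (Enum.to i , x⊏s⊏y)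
  ... | no  ∄           = inj₂ λ s (x⊏s , s⊏y) →
    ∄ ( Enum.from s
      , <-respʳ-≈ (Eq.sym (Enum.strictlyInverseˡ s)) x⊏s
      , <-respˡ-≈ (Eq.sym (Enum.strictlyInverseˡ s)) s⊏y)

-- Ranked posets: monotonicity of the rank

module RankedPosetProperties {c ℓ₁ ℓ₂} (R : RankedPoset c ℓ₁ ℓ₂) where
  open RankedPoset R using (finitePoset; _≟_; <-wellFounded; rank; rank-cong; rank-cover)
    renaming (_≤_ to _⊑_; _<_ to _⊏_)
  open FinitePosetProperties finitePoset using (>-wellFounded; between?)

  rank-mono-< : ∀ {x y} → x ⊏ y → rank x < rank y
  rank-mono-< {x} {y} = go (<-wellFounded y) (>-wellFounded x)
    where
    -- Splitting x ⊏ s ⊏ y lowers the top in one half and raises the bottom in the other.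
    go : ∀ {x y} → Acc _⊏_ y → Acc (flip _⊏_) x → x ⊏ y → rank x < rank y
    go {x} {y} (acc below) (acc above) x⊏y with between? x y
    ... | inj₁ (s , x⊏s , s⊏y) =
      ℤ.<-trans (go (below s⊏y) (acc above) x⊏s) (go (acc below) (above x⊏s) s⊏y)
    ... | inj₂ ∄ = subst (rank x <_) (sym (rank-cover (x⊏y , ∄))) (ℤ.suc[i]≤j⇒i<j (ℤ.≤-reflexive (ℤ.+-comm 1ℤ (rank x))))

  rank-mono-≤ : ∀ {x y} → x ⊑ y → rank x ≤ rank y
  rank-mono-≤ {x} {y} x⊑y with x ≟ y
  ... | yes x≈y = ℤ.≤-reflexive (rank-cong x≈y)
  ... | no  x≉y = ℤ.<⇒≤ (rank-mono-< (x⊑y , x≉y))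

-- Eulerian posets

-- Common shape of both relations: the two end terms are signs times the same face number `F`, and
-- the unknown `n` has sign -1. The coefficient `e + 1ℤ` is the sum of the two end signs.
isolate : ∀ e F S n → e * F + (S + -1ℤ * n + 1ℤ * F) ≡ 0ℤ → n ≡ (e + 1ℤ) * F + S
isolate e F S n e≡0 = begin
  n                                            ≡⟨ ℤ.+-identityʳ n ⟨
  n + 0ℤ                                       ≡⟨ +-congˡ n e≡0 ⟨
  n + (e * F + (S + -1ℤ * n + 1ℤ * F))         ≡⟨ identity e F S n ⟩
  (e + 1ℤ) * F + S                             ∎
  where
  identity : ∀ e F S n → n + (e * F + (S + -1ℤ * n + 1ℤ * F)) ≡ (e + 1ℤ) * F + S
  identity = solve-∀

module EulerianPosetProperties {c ℓ₁ ℓ₂} {d : ℤ} (P : EulerianPoset c ℓ₁ ℓ₂ d) where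
  open EulerianPoset P using
    ( rankedPoset; finitePoset; Carrier; _≈_; _≟_; antisym; module Eq; elements; intervals; μ[_,_]
    ; rank; rank-cong; rank-minimal; 0̂; 1̂; minimum; maximum; rank-1̂; eulerian)
    renaming (_≤_ to _⊑_; _<_ to _⊏_; _≤?_ to _⊑?_; _<?_ to _⊏?_; reflexive to ⊑-reflexive; trans to ⊑-trans)
  open FinitePosetProperties finitePoset
  open RankedPosetProperties rankedPoset

  rank-0̂ : rank 0̂ ≡ -1ℤ
  rank-0̂ = rank-minimal λ s (s⊑0̂ , s≉0̂) → s≉0̂ (antisym s⊑0̂ (minimum s))

  -1≤rank : ∀ x → -1ℤ ≤ rank x
  -1≤rank x = subst (_≤ rank x) rank-0̂ (rank-mono-≤ (minimum x))

  rank≤d : ∀ x → rank x ≤ d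
  rank≤d x = subst (rank x ≤_) rank-1̂ (rank-mono-≤ (maximum x))

  -- Source of the diagonal and boundary values of N: it makes `0̂` the only element of rank -1,
  -- `1̂` the only one of rank `d`, and intervals of length 0 trivial.
  ⊑∧rank≡⇒≈ : ∀ {x y} → x ⊑ y → rank x ≡ rank y → x ≈ y
  ⊑∧rank≡⇒≈ {x} {y} x⊑y e with x ≟ y
  ... | yes x≈y = x≈y
  ... | no  x≉y = contradiction e (ℤ.<⇒≢ (rank-mono-< (x⊑y , x≉y)))

  -- Counts as sums of indicators, and N on the diagonal and the boundary

  f-∑ : ∀ r → + f P r ≡ (∑[ x ∈ elements ] χ (rank x ℤ.≟ r))
  f-∑ r = length-filter (λ x → rank x ℤ.≟ r) elements

  N-∑-intervals : ∀ i j → + N P i j ≡ (∑[ (x , y) ∈ intervals ] χ (rank x ℤ.≟ i) * χ (rank y ℤ.≟ j))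
  N-∑-intervals i j =
    trans (length-filter (λ (x , y) → (rank x ℤ.≟ i) ×-dec (rank y ℤ.≟ j)) intervals)
          (∑-cong intervals (λ (x , y) → χ-× (rank x ℤ.≟ i) (rank y ℤ.≟ j)))

  -- One decision for all three conditions, so that `χ-⇔` can compare it with a single rank
  -- condition.
  counted? : ∀ i j x y → Dec (x ⊑ y × (rank x ≡ i × rank y ≡ j))
  counted? i j x y = (x ⊑? y) ×-dec ((rank x ℤ.≟ i) ×-dec (rank y ℤ.≟ j))

  N-∑ : ∀ i j → + N P i j ≡ (∑[ x ∈ elements ] ∑[ y ∈ elements ] χ (counted? i j x y))
  N-∑ i j =
    trans (N-∑-intervals i j)
    (trans (∑-intervals (λ (x , y) → χ (rank x ℤ.≟ i) * χ (rank y ℤ.≟ j)))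
    (∑-cong elements λ x → ∑-cong elements λ y →
      trans (cong (χ (x ⊑? y) *_) (sym (χ-× (rank x ℤ.≟ i) (rank y ℤ.≟ j))))
            (sym (χ-× (x ⊑? y) ((rank x ℤ.≟ i) ×-dec (rank y ℤ.≟ j))))))

  N-diagonal : ∀ r → N P r r ≡ f P r
  N-diagonal r = ℤ.+-injective (trans (N-∑ r r) (trans (∑-cong elements row) (sym (f-∑ r))))
    where
    row : ∀ x → (∑[ y ∈ elements ] χ (counted? r r x y)) ≡ χ (rank x ℤ.≟ r)
    row x = ∑-elements x
      (λ y y≈x → χ-⇔ (counted? r r x y) (rank x ℤ.≟ r) (proj₁ ∘ proj₂)
        (λ e → ⊑-reflexive (Eq.sym y≈x) , e , trans (rank-cong y≈x) e))
      (λ y y≉x → χ-false (counted? r r x y)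
        (λ (x⊑y , e , e′) → y≉x (Eq.sym (⊑∧rank≡⇒≈ x⊑y (trans e (sym e′))))))

  N-bottom : ∀ r → N P -1ℤ r ≡ f P r
  N-bottom r = ℤ.+-injective
    (trans (N-∑ -1ℤ r)
    -- The pinned element `0̂` is the lower end, so the inner sum must run over `x`.
    (trans (∑-swap elements elements (λ x y → χ (counted? -1ℤ r x y)))
    (trans (∑-cong elements column) (sym (f-∑ r)))))
    where
    column : ∀ y → (∑[ x ∈ elements ] χ (counted? -1ℤ r x y)) ≡ χ (rank y ℤ.≟ r)
    column y = ∑-elements 0̂
      (λ x x≈0̂ → χ-⇔ (counted? -1ℤ r x y) (rank y ℤ.≟ r) (proj₂ ∘ proj₂)
        (λ e → ⊑-trans (⊑-reflexive x≈0̂) (minimum y) , trans (rank-cong x≈0̂) rank-0̂ , e))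
      (λ x x≉0̂ → χ-false (counted? -1ℤ r x y)
        (λ (_ , e , _) → x≉0̂ (Eq.sym (⊑∧rank≡⇒≈ (minimum x) (trans rank-0̂ (sym e))))))

  N-top : ∀ r → N P r d ≡ f P r
  N-top r = ℤ.+-injective (trans (N-∑ r d) (trans (∑-cong elements row) (sym (f-∑ r))))
    where
    row : ∀ x → (∑[ y ∈ elements ] χ (counted? r d x y)) ≡ χ (rank x ℤ.≟ r)
    row x = ∑-elements 1̂
      (λ y y≈1̂ → χ-⇔ (counted? r d x y) (rank x ℤ.≟ r) (proj₁ ∘ proj₂)
        (λ e → ⊑-trans (maximum x) (⊑-reflexive (Eq.sym y≈1̂)) , e , trans (rank-cong y≈1̂) rank-1̂))
      (λ y y≉1̂ → χ-false (counted? r d x y)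
        (λ (_ , _ , e) → y≉1̂ (⊑∧rank≡⇒≈ (maximum y) (trans e (sym rank-1̂)))))

  -- Euler relations, on one interval and summed over intervals

  euler-relation : ∀ {x y} → x ⊏ y →
    (∑[ s ∈ elements ] χ (x ⊑? s) * (χ (s ⊑? y) * [-1]^ (rank s - rank x))) ≡ 0ℤ
  euler-relation {x} {y} x⊏y = begin
    (∑[ s ∈ elements ] χ (x ⊑? s) * (χ (s ⊑? y) * sgn s))  ≡⟨ ∑-cong elements split ⟩
    (∑[ s ∈ elements ] below s + at s)                      ≡⟨ ∑-+ elements below at ⟩
    ∑ elements below + ∑ elements at                        ≡⟨ cong₂ _+_ ∑-below ∑-at ⟩
    - μ[ x , y ] + μ[ x , y ]                               ≡⟨ ℤ.+-inverseˡ μ[ x , y ] ⟩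
    0ℤ                                                      ∎
    where
    sgn below at : Carrier → ℤ
    sgn s   = [-1]^ (rank s - rank x)
    below s = χ (x ⊑? s) * (χ (s ⊏? y) * μ[ x , s ])
    at s    = χ (x ⊑? s) * (χ (s ≟ y) * sgn s)

    split : ∀ s → χ (x ⊑? s) * (χ (s ⊑? y) * sgn s) ≡ below s + at s
    split s = begin
      χ (x ⊑? s) * (χ (s ⊑? y) * sgn s)
        ≡⟨ cong (λ k → χ (x ⊑? s) * (k * sgn s)) (χ-⊑ s y) ⟩
      χ (x ⊑? s) * ((χ (s ⊏? y) + χ (s ≟ y)) * sgn s)
        ≡⟨ distrib (χ (x ⊑? s)) (χ (s ⊏? y)) (χ (s ≟ y)) (sgn s) ⟩
      χ (x ⊑? s) * (χ (s ⊏? y) * sgn s) + at s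
        -- `eulerian` asks for `x ⊑ s`, which the first indicator supplies.
        ≡⟨ cong (_+ at s) (χ-*-cong (x ⊑? s) (λ x⊑s → cong (χ (s ⊏? y) *_) (sym (eulerian x⊑s)))) ⟩
      below s + at s ∎
      where
      distrib : ∀ i j k l → i * ((j + k) * l) ≡ i * (j * l) + i * (k * l)
      distrib = solve-∀

    ∑-below : ∑ elements below ≡ - μ[ x , y ]
    ∑-below = trans (sym (ℤ.neg-involutive (∑ elements below))) (cong -_ (sym (μ-unfold x⊏y)))

    ∑-at : ∑ elements at ≡ μ[ x , y ]
    ∑-at = trans
      (∑-elements y
        (λ s s≈y → trans
          (cong₂ (λ j k → j * (k * sgn s))
            (χ-true (x ⊑? s) (⊑-trans (proj₁ x⊏y) (⊑-reflexive (Eq.sym s≈y)))) (χ-true (s ≟ y) s≈y))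
          (trans (trans (ℤ.*-identityˡ (1ℤ * sgn s)) (ℤ.*-identityˡ (sgn s)))
                 (cong (λ r → [-1]^ (r - rank x)) (rank-cong s≈y))))
        (λ s s≉y → trans (cong (λ k → χ (x ⊑? s) * (k * sgn s)) (χ-false (s ≟ y) s≉y))
                         (ℤ.*-zeroʳ (χ (x ⊑? s)))))
      (sym (eulerian (proj₁ x⊏y)))

  -- An interval with upper rank `j` is counted in `N P k j` for exactly one `k`, the rank of its
  -- lower end, and so receives the weight `G` at that rank.
  ∑-N-below : ∀ j (G : ℤ → ℤ) → (∑[ k ∈ [ -1ℤ ⋯ j ] ] G k * + N P k j)
              ≡ (∑[ (x , y) ∈ intervals ] χ (rank y ℤ.≟ j) * G (rank x))
  ∑-N-below j G = begin
    (∑[ k ∈ range ] G k * + N P k j)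
      ≡⟨ ∑-cong range (λ k → trans (cong (G k *_) (N-∑-intervals k j)) (sym (∑-*ˡ intervals (G k) (count k)))) ⟩
    (∑[ k ∈ range ] ∑[ I ∈ intervals ] G k * count k I)
      ≡⟨ ∑-swap range intervals (λ k I → G k * count k I) ⟩
    (∑[ I ∈ intervals ] ∑[ k ∈ range ] G k * count k I)
      ≡⟨ ∑-intervals-cong collapse ⟩
    (∑[ (x , y) ∈ intervals ] χ (rank y ℤ.≟ j) * G (rank x)) ∎
    where
    range = [ -1ℤ ⋯ j ]
    count : ℤ → Carrier × Carrier → ℤ
    count k (x , y) = χ (rank x ℤ.≟ k) * χ (rank y ℤ.≟ j)
    rotate : ∀ i k l → i * (k * l) ≡ l * (k * i)
    rotate = solve-∀
    collapse : ∀ x y → x ⊑ y → (∑[ k ∈ range ] G k * count k (x , y)) ≡ χ (rank y ℤ.≟ j) * G (rank x)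
    collapse x y x⊑y = begin
      (∑[ k ∈ range ] G k * count k (x , y))
        ≡⟨ ∑-cong range (λ k → rotate (G k) (χ (rank x ℤ.≟ k)) (χ (rank y ℤ.≟ j))) ⟩
      (∑[ k ∈ range ] χ (rank y ℤ.≟ j) * (χ (rank x ℤ.≟ k) * G k))
        ≡⟨ ∑-*ˡ range (χ (rank y ℤ.≟ j)) (λ k → χ (rank x ℤ.≟ k) * G k) ⟩
      χ (rank y ℤ.≟ j) * (∑[ k ∈ range ] χ (rank x ℤ.≟ k) * G k)
        -- That `rank x` lies in the range follows from `x ⊑ y` only once `rank y` is `j`.
        ≡⟨ χ-*-cong (rank y ℤ.≟ j) (λ { refl → ∑-⋯-χ (-1≤rank x) (rank-mono-≤ x⊑y) G }) ⟩
      χ (rank y ℤ.≟ j) * G (rank x) ∎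

  -- The weight is arbitrary because two are needed: signs in `euler-above`, and coefficients of
  -- powers of -z in `möbius≈rank`.
  ∑-N-above : ∀ i (G : ℤ → ℤ) → (∑[ k ∈ [ i ⋯ d ] ] G k * + N P i k)
              ≡ (∑[ (x , y) ∈ intervals ] χ (rank x ℤ.≟ i) * G (rank y))
  ∑-N-above i G = begin
    (∑[ k ∈ range ] G k * + N P i k)
      ≡⟨ ∑-cong range (λ k → trans (cong (G k *_) (N-∑-intervals i k)) (sym (∑-*ˡ intervals (G k) (count k)))) ⟩
    (∑[ k ∈ range ] ∑[ I ∈ intervals ] G k * count k I)
      ≡⟨ ∑-swap range intervals (λ k I → G k * count k I) ⟩
    (∑[ I ∈ intervals ] ∑[ k ∈ range ] G k * count k I)
      ≡⟨ ∑-intervals-cong collapse ⟩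
    (∑[ (x , y) ∈ intervals ] χ (rank x ℤ.≟ i) * G (rank y)) ∎
    where
    range = [ i ⋯ d ]
    count : ℤ → Carrier × Carrier → ℤ
    count k (x , y) = χ (rank x ℤ.≟ i) * χ (rank y ℤ.≟ k)
    rotate : ∀ i k l → i * (k * l) ≡ k * (l * i)
    rotate = solve-∀
    collapse : ∀ x y → x ⊑ y → (∑[ k ∈ range ] G k * count k (x , y)) ≡ χ (rank x ℤ.≟ i) * G (rank y)
    collapse x y x⊑y = begin
      (∑[ k ∈ range ] G k * count k (x , y))
        ≡⟨ ∑-cong range (λ k → rotate (G k) (χ (rank x ℤ.≟ i)) (χ (rank y ℤ.≟ k))) ⟩
      (∑[ k ∈ range ] χ (rank x ℤ.≟ i) * (χ (rank y ℤ.≟ k) * G k))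
        ≡⟨ ∑-*ˡ range (χ (rank x ℤ.≟ i)) (λ k → χ (rank y ℤ.≟ k) * G k) ⟩
      χ (rank x ℤ.≟ i) * (∑[ k ∈ range ] χ (rank y ℤ.≟ k) * G k)
        ≡⟨ χ-*-cong (rank x ℤ.≟ i) (λ { refl → ∑-⋯-χ (rank-mono-≤ x⊑y) (rank≤d y) G }) ⟩
      χ (rank x ℤ.≟ i) * G (rank y) ∎

  euler-below : ∀ j → -1ℤ < j → (∑[ k ∈ [ -1ℤ ⋯ j ] ] [-1]^ (j - k) * + N P k j) ≡ 0ℤ
  euler-below j -1<j = begin
    (∑[ k ∈ [ -1ℤ ⋯ j ] ] [-1]^ (j - k) * + N P k j)
      ≡⟨ ∑-N-below j (λ k → [-1]^ (j - k)) ⟩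
    (∑[ (x , y) ∈ intervals ] χ (rank y ℤ.≟ j) * [-1]^ (j - rank x))
      ≡⟨ ∑-intervals (λ (x , y) → χ (rank y ℤ.≟ j) * [-1]^ (j - rank x)) ⟩
    (∑[ x ∈ elements ] ∑[ y ∈ elements ] χ (x ⊑? y) * (χ (rank y ℤ.≟ j) * [-1]^ (j - rank x)))
      ≡⟨ ∑-swap elements elements (λ x y → χ (x ⊑? y) * (χ (rank y ℤ.≟ j) * [-1]^ (j - rank x))) ⟩
    (∑[ y ∈ elements ] ∑[ x ∈ elements ] χ (x ⊑? y) * (χ (rank y ℤ.≟ j) * [-1]^ (j - rank x)))
      ≡⟨ ∑-zero elements (All.universal column elements) ⟩
    0ℤ ∎
    where
    sgn : ℤ
    sgn = [-1]^ (j - rank 0̂)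

    term : Carrier → Carrier → ℤ
    term y x = χ (0̂ ⊑? x) * (χ (x ⊑? y) * [-1]^ (rank x - rank 0̂))

    -- The factor `1ℤ` holds the place of the indicator of `0̂ ⊑ x`, true for every `x`, which gives
    -- each column the form of `euler-relation` on the interval from `0̂` to `y`.
    rearrange : ∀ i k l m → i * (k * (l * m)) ≡ k * (l * (1ℤ * (i * m)))
    rearrange = solve-∀

    factor : ∀ y x → χ (x ⊑? y) * (χ (rank y ℤ.≟ j) * [-1]^ (j - rank x))
                     ≡ χ (rank y ℤ.≟ j) * (sgn * term y x)
    factor y x = begin
      χ (x ⊑? y) * (χ (rank y ℤ.≟ j) * [-1]^ (j - rank x))
        ≡⟨ cong (λ k → χ (x ⊑? y) * (χ (rank y ℤ.≟ j) * k)) ([-1]^-difference (rank 0̂) (rank x) j) ⟩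
      χ (x ⊑? y) * (χ (rank y ℤ.≟ j) * (sgn * [-1]^ (rank x - rank 0̂)))
        ≡⟨ rearrange (χ (x ⊑? y)) (χ (rank y ℤ.≟ j)) sgn ([-1]^ (rank x - rank 0̂)) ⟩
      χ (rank y ℤ.≟ j) * (sgn * (1ℤ * (χ (x ⊑? y) * [-1]^ (rank x - rank 0̂))))
        ≡⟨ cong (λ k → χ (rank y ℤ.≟ j) * (sgn * (k * (χ (x ⊑? y) * [-1]^ (rank x - rank 0̂)))))
                (χ-true (0̂ ⊑? x) (minimum x)) ⟨
      χ (rank y ℤ.≟ j) * (sgn * term y x) ∎

    0̂⊏ : ∀ {y} → rank y ≡ j → 0̂ ⊏ y
    0̂⊏ {y} refl = minimum y , λ 0̂≈y → ℤ.<⇒≢ -1<j (trans (sym rank-0̂) (rank-cong 0̂≈y))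

    column : ∀ y → (∑[ x ∈ elements ] χ (x ⊑? y) * (χ (rank y ℤ.≟ j) * [-1]^ (j - rank x))) ≡ 0ℤ
    column y = begin
      (∑[ x ∈ elements ] χ (x ⊑? y) * (χ (rank y ℤ.≟ j) * [-1]^ (j - rank x)))
        ≡⟨ ∑-cong elements (factor y) ⟩
      (∑[ x ∈ elements ] χ (rank y ℤ.≟ j) * (sgn * term y x))
        ≡⟨ ∑-*ˡ elements (χ (rank y ℤ.≟ j)) (λ x → sgn * term y x) ⟩
      χ (rank y ℤ.≟ j) * (∑[ x ∈ elements ] sgn * term y x)
        ≡⟨ χ-*-cong (rank y ℤ.≟ j) (λ e →
             trans (∑-*ˡ elements sgn (term y))
                   (trans (cong (sgn *_) (euler-relation (0̂⊏ e))) (ℤ.*-zeroʳ sgn))) ⟩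
      χ (rank y ℤ.≟ j) * 0ℤ
        ≡⟨ ℤ.*-zeroʳ (χ (rank y ℤ.≟ j)) ⟩
      0ℤ ∎

  euler-above : ∀ i → i < d → (∑[ k ∈ [ i ⋯ d ] ] [-1]^ (d - k) * + N P i k) ≡ 0ℤ
  euler-above i i<d = begin
    (∑[ k ∈ [ i ⋯ d ] ] [-1]^ (d - k) * + N P i k)
      ≡⟨ ∑-N-above i (λ k → [-1]^ (d - k)) ⟩
    (∑[ (x , y) ∈ intervals ] χ (rank x ℤ.≟ i) * [-1]^ (d - rank y))
      ≡⟨ ∑-intervals (λ (x , y) → χ (rank x ℤ.≟ i) * [-1]^ (d - rank y)) ⟩
    (∑[ x ∈ elements ] ∑[ y ∈ elements ] χ (x ⊑? y) * (χ (rank x ℤ.≟ i) * [-1]^ (d - rank y)))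
      ≡⟨ ∑-zero elements (All.universal row elements) ⟩
    0ℤ ∎
    where
    -- Varies with `x` but is constant along the row of `x`, so it leaves the inner sum.
    sgn : Carrier → ℤ
    sgn x = [-1]^ (d - rank x)

    term : Carrier → Carrier → ℤ
    term x y = χ (x ⊑? y) * (χ (y ⊑? 1̂) * [-1]^ (rank y - rank x))

    rearrange : ∀ i k l m → i * (k * (l * m)) ≡ k * (l * (i * (1ℤ * m)))
    rearrange = solve-∀

    factor : ∀ x y → χ (x ⊑? y) * (χ (rank x ℤ.≟ i) * [-1]^ (d - rank y))
                     ≡ χ (rank x ℤ.≟ i) * (sgn x * term x y)
    factor x y = begin
      χ (x ⊑? y) * (χ (rank x ℤ.≟ i) * [-1]^ (d - rank y))
        ≡⟨ cong (λ k → χ (x ⊑? y) * (χ (rank x ℤ.≟ i) * k)) ([-1]^-difference (rank x) (rank y) d) ⟩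
      χ (x ⊑? y) * (χ (rank x ℤ.≟ i) * (sgn x * [-1]^ (rank y - rank x)))
        ≡⟨ rearrange (χ (x ⊑? y)) (χ (rank x ℤ.≟ i)) (sgn x) ([-1]^ (rank y - rank x)) ⟩
      χ (rank x ℤ.≟ i) * (sgn x * (χ (x ⊑? y) * (1ℤ * [-1]^ (rank y - rank x))))
        ≡⟨ cong (λ k → χ (rank x ℤ.≟ i) * (sgn x * (χ (x ⊑? y) * (k * [-1]^ (rank y - rank x)))))
                (χ-true (y ⊑? 1̂) (maximum y)) ⟨
      χ (rank x ℤ.≟ i) * (sgn x * term x y) ∎

    ⊏1̂ : ∀ {x} → rank x ≡ i → x ⊏ 1̂
    ⊏1̂ {x} refl = maximum x , λ x≈1̂ → ℤ.<⇒≢ i<d (trans (rank-cong x≈1̂) rank-1̂)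

    row : ∀ x → (∑[ y ∈ elements ] χ (x ⊑? y) * (χ (rank x ℤ.≟ i) * [-1]^ (d - rank y))) ≡ 0ℤ
    row x = begin
      (∑[ y ∈ elements ] χ (x ⊑? y) * (χ (rank x ℤ.≟ i) * [-1]^ (d - rank y)))
        ≡⟨ ∑-cong elements (factor x) ⟩
      (∑[ y ∈ elements ] χ (rank x ℤ.≟ i) * (sgn x * term x y))
        ≡⟨ ∑-*ˡ elements (χ (rank x ℤ.≟ i)) (λ y → sgn x * term x y) ⟩
      χ (rank x ℤ.≟ i) * (∑[ y ∈ elements ] sgn x * term x y)
        ≡⟨ χ-*-cong (rank x ℤ.≟ i) (λ e →
             trans (∑-*ˡ elements (sgn x) (term x))
                   (trans (cong (sgn x *_) (euler-relation (⊏1̂ e))) (ℤ.*-zeroʳ (sgn x)))) ⟩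
      χ (rank x ℤ.≟ i) * 0ℤ
        ≡⟨ ℤ.*-zeroʳ (χ (rank x ℤ.≟ i)) ⟩
      0ℤ ∎

  -- The relations solved for N

  N-adjacent : ∀ i → 0ℤ ≤ i →
    + N P i (i + 1ℤ)
      ≡ ([-1]^ i + 1ℤ) * + f P (i + 1ℤ)
        + (∑[ k ∈ [ 0ℤ ⋯ i - 1ℤ ] ] [-1]^ (i + 1ℤ - k) * + N P k (i + 1ℤ))
  N-adjacent i 0≤i = isolate ([-1]^ i) (+ f P j) (∑ [ 0ℤ ⋯ i - 1ℤ ] t) (+ N P i j) (begin
    [-1]^ i * + f P j + (∑ [ 0ℤ ⋯ i - 1ℤ ] t + -1ℤ * + N P i j + 1ℤ * + f P j)
      ≡⟨ cong₂ (λ k l → k + (∑ [ 0ℤ ⋯ i - 1ℤ ] t + l + 1ℤ * + f P j)) t-bottom t-i ⟨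
    t -1ℤ + (∑ [ 0ℤ ⋯ i - 1ℤ ] t + t i + 1ℤ * + f P j)
      ≡⟨ cong₂ (λ k l → t -1ℤ + (k + l)) (∑-⋯-snoc 0≤i t) t-j ⟨
    t -1ℤ + (∑ [ 0ℤ ⋯ i ] t + t j)
      ≡⟨ cong (λ k → t -1ℤ + (∑ [ 0ℤ ⋯ k ] t + t j)) (pred-suc i) ⟨
    t -1ℤ + (∑ [ 0ℤ ⋯ j - 1ℤ ] t + t j)
      ≡⟨ +-congˡ (t -1ℤ) (∑-⋯-snoc 0≤j t) ⟨
    t -1ℤ + ∑ [ 0ℤ ⋯ j ] t
      ≡⟨ ∑-⋯-cons (ℤ.<⇒≤ -1<j) t ⟨
    ∑ [ -1ℤ ⋯ j ] t
      ≡⟨ euler-below j -1<j ⟩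
    0ℤ ∎)
    where
    j = i + 1ℤ
    t : ℤ → ℤ
    t k = [-1]^ (j - k) * + N P k j
    0≤j : 0ℤ ≤ j
    0≤j = ℤ.≤-trans 0≤i (ℤ.i≤i+j i 1ℤ)
    -1<j : -1ℤ < j
    -1<j = ℤ.<-≤-trans -<+ 0≤j
    pred-suc : ∀ i → i + 1ℤ - 1ℤ ≡ i
    pred-suc = solve-∀
    shift : ∀ i → i + 1ℤ - -1ℤ ≡ i + + 2
    shift = solve-∀
    one : ∀ i → i + 1ℤ - i ≡ 1ℤ
    one = solve-∀
    -- Rank -1 lies `i + 2` below rank `i + 1`, and the 2 does not affect the sign.
    t-bottom : t -1ℤ ≡ [-1]^ i * + f P j
    t-bottom = cong₂ (λ k n → k * + n)
      (trans (cong [-1]^_ (shift i)) (trans ([-1]^-+-ℕ i 2) (ℤ.*-identityʳ ([-1]^ i)))) (N-bottom j)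
    t-i : t i ≡ -1ℤ * + N P i j
    t-i = cong (λ k → [-1]^ k * + N P i j) (one i)
    t-j : t j ≡ 1ℤ * + f P j
    t-j = cong₂ (λ k n → [-1]^ k * + n) (ℤ.+-inverseʳ j) (N-diagonal j)

  N-coatom : ∀ i → i ≤ d - + 2 →
    + N P i (d - 1ℤ)
      ≡ ([-1]^ (d - i) + 1ℤ) * + f P i
        + (∑[ j ∈ [ i + 1ℤ ⋯ d - + 2 ] ] [-1]^ (d - j) * + N P i j)
  N-coatom i i≤d-2 = isolate ([-1]^ (d - i)) (+ f P i) (∑ [ i + 1ℤ ⋯ d - + 2 ] t) (+ N P i (d - 1ℤ)) (begin
    [-1]^ (d - i) * + f P i + (∑ [ i + 1ℤ ⋯ d - + 2 ] t + -1ℤ * + N P i (d - 1ℤ) + 1ℤ * + f P i)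
      ≡⟨ cong₂ (λ k l → k + (∑ [ i + 1ℤ ⋯ d - + 2 ] t + l + 1ℤ * + f P i)) t-i t-coatom ⟨
    t i + (∑ [ i + 1ℤ ⋯ d - + 2 ] t + t (d - 1ℤ) + 1ℤ * + f P i)
      ≡⟨ cong₂ (λ k l → t i + (∑ [ i + 1ℤ ⋯ k ] t + t (d - 1ℤ) + l)) (pred-pred d) t-d ⟨
    t i + (∑ [ i + 1ℤ ⋯ d - 1ℤ - 1ℤ ] t + t (d - 1ℤ) + t d)
      ≡⟨ cong (λ k → t i + (k + t d)) (∑-⋯-snoc i+1≤d-1 t) ⟨
    t i + (∑ [ i + 1ℤ ⋯ d - 1ℤ ] t + t d)
      ≡⟨ +-congˡ (t i) (∑-⋯-snoc i+1≤d t) ⟨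
    t i + ∑ [ i + 1ℤ ⋯ d ] t
      ≡⟨ ∑-⋯-cons (ℤ.<⇒≤ i<d) t ⟨
    ∑ [ i ⋯ d ] t
      ≡⟨ euler-above i i<d ⟩
    0ℤ ∎)
    where
    t : ℤ → ℤ
    t k = [-1]^ (d - k) * + N P i k
    shift : ∀ d i → d - + 2 - i ≡ d - 1ℤ - (i + 1ℤ)
    shift = solve-∀
    i+1≤d-1 : i + 1ℤ ≤ d - 1ℤ
    i+1≤d-1 = ≤-by (shift d i) i≤d-2
    i+1≤d : i + 1ℤ ≤ d
    i+1≤d = ℤ.≤-trans i+1≤d-1 (ℤ.i-j≤i d 1ℤ)
    i<d : i < d
    i<d = ℤ.suc[i]≤j⇒i<j (subst (_≤ d) (ℤ.+-comm i 1ℤ) i+1≤d)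
    pred-pred : ∀ d → d - 1ℤ - 1ℤ ≡ d - + 2
    pred-pred = solve-∀
    one : ∀ d → d - (d - 1ℤ) ≡ 1ℤ
    one = solve-∀
    t-i : t i ≡ [-1]^ (d - i) * + f P i
    t-i = cong (λ n → [-1]^ (d - i) * + n) (N-diagonal i)
    t-coatom : t (d - 1ℤ) ≡ -1ℤ * + N P i (d - 1ℤ)
    t-coatom = cong (λ k → [-1]^ k * + N P i (d - 1ℤ)) (one d)
    t-d : t d ≡ 1ℤ * + f P i
    t-d = cong₂ (λ k n → [-1]^ k * + n) (ℤ.+-inverseʳ d) (N-top i)

  N-edge : + N P 0ℤ 1ℤ ≡ + 2 * + f P 1ℤ
  -- At `i = 0` the coefficient evaluates to 2 and the range from 0 to -1 to the empty list.
  N-edge = trans (N-adjacent 0ℤ ℤ.≤-refl) (ℤ.+-identityʳ (+ 2 * + f P 1ℤ))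

  N-ridge : + N P (d - + 2) (d - 1ℤ) ≡ + 2 * + f P (d - + 2)
  N-ridge = begin
    + N P (d - + 2) (d - 1ℤ)
      ≡⟨ N-coatom (d - + 2) ℤ.≤-refl ⟩
    ([-1]^ (d - (d - + 2)) + 1ℤ) * + f P (d - + 2) + ∑ [ d - + 2 + 1ℤ ⋯ d - + 2 ] t
      -- At `i = d - 2` the sum is again empty, but `d` is a variable and nothing evaluates: the
      -- exponent 2 and the length 0 have to be proved.
      ≡⟨ cong₂ (λ k l → ([-1]^ k + 1ℤ) * + f P (d - + 2) + ∑ l t) (two d)
           (⋯-applyUpTo (d - + 2 + 1ℤ) (d - + 2) 0 (empty d)) ⟩
    + 2 * + f P (d - + 2) + 0ℤ
      ≡⟨ ℤ.+-identityʳ (+ 2 * + f P (d - + 2)) ⟩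
    + 2 * + f P (d - + 2) ∎
    where
    t : ℤ → ℤ
    t k = [-1]^ (d - k) * + N P (d - + 2) k
    two : ∀ d → d - (d - + 2) ≡ + 2
    two = solve-∀
    empty : ∀ d → d - + 2 - (d - + 2 + 1ℤ) + 1ℤ ≡ 0ℤ
    empty = solve-∀

  -- The Möbius polynomial in terms of ranks

  rankPolynomial : Poly
  rankPolynomial = ∑ᴾ[ i ∈ [ -1ℤ ⋯ d ] ] ∑ᴾ[ j ∈ [ i ⋯ d ] ] (+ N P i j) ·ᴾ (-ᴾ 𝑧) ^ᴾ ∣ j - i ∣

  coeff-rankPolynomial : ∀ k → coeff rankPolynomial k
    ≡ (∑[ i ∈ [ -1ℤ ⋯ d ] ] ∑[ j ∈ [ i ⋯ d ] ] + N P i j * coeff ((-ᴾ 𝑧) ^ᴾ ∣ j - i ∣) k)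
  coeff-rankPolynomial k =
    trans (coeff-∑ᴾ [ -1ℤ ⋯ d ] (λ i → ∑ᴾ[ j ∈ [ i ⋯ d ] ] (+ N P i j) ·ᴾ (-ᴾ 𝑧) ^ᴾ ∣ j - i ∣) k)
          (∑-cong [ -1ℤ ⋯ d ] λ i →
            trans (coeff-∑ᴾ [ i ⋯ d ] (λ j → (+ N P i j) ·ᴾ (-ᴾ 𝑧) ^ᴾ ∣ j - i ∣) k)
                  (∑-cong [ i ⋯ d ] λ j → coeff-·ᴾ (+ N P i j) ((-ᴾ 𝑧) ^ᴾ ∣ j - i ∣) k))

  -- For a fixed degree `k`, the Eulerian condition makes the contribution of an interval a function
  -- `G` of its two ranks, so intervals can be collected by rank.
  möbius≈rank : möbiusPolynomial P ≈ᴾ rankPolynomial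
  möbius≈rank k = begin
    coeff (möbiusPolynomial P) k
      ≡⟨ coeff-∑ᴾ intervals (λ (x , y) → μ[ x , y ] ·ᴾ 𝑧 ^ᴾ ∣ rank y - rank x ∣) k ⟩
    (∑[ (x , y) ∈ intervals ] coeff (μ[ x , y ] ·ᴾ 𝑧 ^ᴾ ∣ rank y - rank x ∣) k)
      ≡⟨ ∑-intervals-cong (λ x y x⊑y → begin
           coeff (μ[ x , y ] ·ᴾ 𝑧 ^ᴾ ∣ rank y - rank x ∣) k
             ≡⟨ coeff-·ᴾ μ[ x , y ] (𝑧 ^ᴾ ∣ rank y - rank x ∣) k ⟩
           μ[ x , y ] * coeff (𝑧 ^ᴾ ∣ rank y - rank x ∣) k
             ≡⟨ cong (_* coeff (𝑧 ^ᴾ ∣ rank y - rank x ∣) k) (eulerian x⊑y) ⟩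
           [-1]^ (rank y - rank x) * coeff (𝑧 ^ᴾ ∣ rank y - rank x ∣) k
             ≡⟨ coeff-linear-^ -1ℤ ∣ rank y - rank x ∣ k ⟨
           G (rank x) (rank y)
             -- Introduces the lower rank as a summation index; exchanging the sums then leaves, for
             -- each `i`, the right side of `∑-N-above`.
             ≡⟨ ∑-⋯-χ (-1≤rank x) (rank≤d x) (λ i → G i (rank y)) ⟨
           (∑[ i ∈ [ -1ℤ ⋯ d ] ] χ (rank x ℤ.≟ i) * G i (rank y)) ∎) ⟩
    (∑[ (x , y) ∈ intervals ] ∑[ i ∈ [ -1ℤ ⋯ d ] ] χ (rank x ℤ.≟ i) * G i (rank y))
      ≡⟨ ∑-swap intervals [ -1ℤ ⋯ d ] (λ (x , y) i → χ (rank x ℤ.≟ i) * G i (rank y)) ⟩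
    (∑[ i ∈ [ -1ℤ ⋯ d ] ] ∑[ (x , y) ∈ intervals ] χ (rank x ℤ.≟ i) * G i (rank y))
      ≡⟨ ∑-cong [ -1ℤ ⋯ d ] (λ i → trans (sym (∑-N-above i (G i)))
           (∑-cong [ i ⋯ d ] (λ j → ℤ.*-comm (G i j) (+ N P i j)))) ⟩
    (∑[ i ∈ [ -1ℤ ⋯ d ] ] ∑[ j ∈ [ i ⋯ d ] ] + N P i j * G i j)
      ≡⟨ coeff-rankPolynomial k ⟨
    coeff rankPolynomial k ∎
    where
    G : ℤ → ℤ → ℤ
    G i j = coeff ((-ᴾ 𝑧) ^ᴾ ∣ j - i ∣) k

-- Determination by the f-vector and the prescribed values of N

≤∧≢⇒+1≤ : ∀ {i j} → i ≤ j → i ≢ j → i + 1ℤ ≤ j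
≤∧≢⇒+1≤ {i} {j} i≤j i≢j = subst (_≤ j) (ℤ.+-comm 1ℤ i) (ℤ.i<j⇒suc[i]≤j (ℤ.≤∧≢⇒< i≤j i≢j))

module Determination {c ℓ₁ ℓ₂} {d : ℤ} (P Q : EulerianPoset c ℓ₁ ℓ₂ d)
  (f-agree : ∀ r → -1ℤ ≤ r → r ≤ d → f P r ≡ f Q r)
  (N-agree : ∀ i j → 0ℤ ≤ i → i + + 2 ≤ j → j ≤ d - + 2 → N P i j ≡ N Q i j) where

  private
    module P = EulerianPosetProperties P
    module Q = EulerianPosetProperties Q

  -- In the sum k ≤ i - 1, that is k + 2 ≤ i + 1, so every term falls under `N-agree`.
  N-adjacent-agree : ∀ i → 0ℤ ≤ i → i + 1ℤ ≤ d - + 2 → N P i (i + 1ℤ) ≡ N Q i (i + 1ℤ)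
  N-adjacent-agree i 0≤i i+1≤d-2 = ℤ.+-injective
    (trans (P.N-adjacent i 0≤i)
    (trans (cong₂ (λ n s → ([-1]^ i + 1ℤ) * + n + s)
      (f-agree (i + 1ℤ) (ℤ.≤-trans -≤+ (ℤ.≤-trans 0≤i (ℤ.i≤i+j i 1ℤ))) (ℤ.≤-trans i+1≤d-2 (ℤ.i-j≤i d (+ 2))))
      (∑-cong∈ [ 0ℤ ⋯ i - 1ℤ ] λ {k} k∈ → let 0≤k , k≤i-1 = ∈-⋯⁻ 0ℤ (i - 1ℤ) k∈ in
        cong (λ n → [-1]^ (i + 1ℤ - k) * + n)
             (N-agree k (i + 1ℤ) 0≤k (≤-by (shift i k) k≤i-1) i+1≤d-2)))
    (sym (Q.N-adjacent i 0≤i))))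
    where
    shift : ∀ i k → i - 1ℤ - k ≡ i + 1ℤ - (k + + 2)
    shift = solve-∀

  N-below-coatom-agree : ∀ i j → 0ℤ ≤ i → i + 1ℤ ≤ j → j ≤ d - + 2 → N P i j ≡ N Q i j
  N-below-coatom-agree i j 0≤i i+1≤j j≤d-2 with i + 1ℤ ℤ.≟ j
  ... | yes refl  = N-adjacent-agree i 0≤i j≤d-2
  ... | no  i+1≢j = N-agree i j 0≤i (subst (_≤ j) (ℤ.+-assoc i 1ℤ 1ℤ) (≤∧≢⇒+1≤ i+1≤j i+1≢j)) j≤d-2

  N-coatom-agree : ∀ i → 0ℤ ≤ i → i ≤ d - + 2 → N P i (d - 1ℤ) ≡ N Q i (d - 1ℤ)
  N-coatom-agree i 0≤i i≤d-2 = ℤ.+-injective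
    (trans (P.N-coatom i i≤d-2)
    (trans (cong₂ (λ n s → ([-1]^ (d - i) + 1ℤ) * + n + s)
      (f-agree i (ℤ.≤-trans -≤+ 0≤i) (ℤ.≤-trans i≤d-2 (ℤ.i-j≤i d (+ 2))))
      (∑-cong∈ [ i + 1ℤ ⋯ d - + 2 ] λ {j} j∈ → let i+1≤j , j≤d-2 = ∈-⋯⁻ (i + 1ℤ) (d - + 2) j∈ in
        cong (λ n → [-1]^ (d - j) * + n) (N-below-coatom-agree i j 0≤i i+1≤j j≤d-2)))
    (sym (Q.N-coatom i i≤d-2))))

  -- Peels the triangle of indices: i = -1, j = d and i = j reduce to face numbers, j = d - 1 is
  -- `N-coatom-agree`, and the rest satisfies 0 ≤ i < j ≤ d - 2.
  N-determined : ∀ i j → -1ℤ ≤ i → i ≤ j → j ≤ d → N P i j ≡ N Q i j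
  N-determined i j -1≤i i≤j j≤d with -1ℤ ℤ.≟ i
  ... | yes refl = trans (P.N-bottom j) (trans (f-agree j i≤j j≤d) (sym (Q.N-bottom j)))
  ... | no -1≢i with j ℤ.≟ d
  ...   | yes refl = trans (P.N-top i) (trans (f-agree i -1≤i i≤j) (sym (Q.N-top i)))
  ...   | no j≢d with i ℤ.≟ j
  ...     | yes refl = trans (P.N-diagonal i) (trans (f-agree i -1≤i j≤d) (sym (Q.N-diagonal i)))
  ...     | no i≢j with j ℤ.≟ d - 1ℤ
  ...       | yes refl = N-coatom-agree i (≤∧≢⇒+1≤ -1≤i -1≢i) (≤-by (shift i d) (≤∧≢⇒+1≤ i≤j i≢j))
    where
    shift : ∀ i d → d - 1ℤ - (i + 1ℤ) ≡ d - + 2 - i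
    shift = solve-∀
  ...       | no j≢d-1 = N-below-coatom-agree i j (≤∧≢⇒+1≤ -1≤i -1≢i) (≤∧≢⇒+1≤ i≤j i≢j)
    (≤-by (shift′ j d) (≤∧≢⇒+1≤ (≤-by (shift j d) (≤∧≢⇒+1≤ j≤d j≢d)) j≢d-1))
    where
    shift : ∀ j d → d - (j + 1ℤ) ≡ d - 1ℤ - j
    shift = solve-∀
    shift′ : ∀ j d → d - 1ℤ - (j + 1ℤ) ≡ d - + 2 - j
    shift′ = solve-∀

  möbiusPolynomial-determined : möbiusPolynomial P ≈ᴾ möbiusPolynomial Q
  möbiusPolynomial-determined k = begin
    coeff (möbiusPolynomial P) k  ≡⟨ P.möbius≈rank k ⟩
    coeff P.rankPolynomial k      ≡⟨ P.coeff-rankPolynomial k ⟩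
    (∑[ i ∈ [ -1ℤ ⋯ d ] ] ∑[ j ∈ [ i ⋯ d ] ] + N P i j * coeff ((-ᴾ 𝑧) ^ᴾ ∣ j - i ∣) k)
      ≡⟨ ∑-cong∈ [ -1ℤ ⋯ d ] (λ {i} i∈ → ∑-cong∈ [ i ⋯ d ] (λ {j} j∈ →
           let -1≤i , _ = ∈-⋯⁻ -1ℤ d i∈ ; i≤j , j≤d = ∈-⋯⁻ i d j∈ in
           cong (λ n → + n * coeff ((-ᴾ 𝑧) ^ᴾ ∣ j - i ∣) k) (N-determined i j -1≤i i≤j j≤d))) ⟩
    (∑[ i ∈ [ -1ℤ ⋯ d ] ] ∑[ j ∈ [ i ⋯ d ] ] + N Q i j * coeff ((-ᴾ 𝑧) ^ᴾ ∣ j - i ∣) k)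
                                  ≡⟨ Q.coeff-rankPolynomial k ⟨
    coeff Q.rankPolynomial k      ≡⟨ Q.möbius≈rank k ⟨
    coeff (möbiusPolynomial Q) k  ∎

mainTheorem18 :
  ∀ {c ℓ₁ ℓ₂} {d : ℤ} → + 3 ≤ d → (P : EulerianPoset c ℓ₁ ℓ₂ d) →
    (möbiusPolynomial P ≈ᴾ
       (∑ᴾ[ i ∈ [ -1ℤ ⋯ d ] ] ∑ᴾ[ j ∈ [ i ⋯ d ] ] (+ N P i j) ·ᴾ (-ᴾ 𝑧) ^ᴾ ∣ j - i ∣))
    × (∀ r → -1ℤ ≤ r → r ≤ d →
         N P r r ≡ f P r × N P -1ℤ r ≡ f P r × N P r d ≡ f P r)
    × (+ N P 0ℤ 1ℤ ≡ + 2 * + f P 1ℤ)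
    × (∀ i → 1ℤ ≤ i → i ≤ d - + 3 →
         + N P i (i + 1ℤ)
           ≡ ([-1]^ i + 1ℤ) * + f P (i + 1ℤ)
             + (∑[ k ∈ [ 0ℤ ⋯ i - 1ℤ ] ] [-1]^ (i + 1ℤ - k) * + N P k (i + 1ℤ)))
    × (+ N P (d - + 2) (d - 1ℤ) ≡ + 2 * + f P (d - + 2))
    × (∀ i → 0ℤ ≤ i → i ≤ d - + 3 →
         + N P i (d - 1ℤ)
           ≡ ([-1]^ (d - i) + 1ℤ) * + f P i
             + (∑[ j ∈ [ i + 1ℤ ⋯ d - + 2 ] ] [-1]^ (d - j) * + N P i j))
    × (∀ (Q : EulerianPoset c ℓ₁ ℓ₂ d) →
         (∀ r → -1ℤ ≤ r → r ≤ d → f P r ≡ f Q r) →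
         (∀ i j → 0ℤ ≤ i → i + + 2 ≤ j → j ≤ d - + 2 → N P i j ≡ N Q i j) →
         ∀ i j → -1ℤ ≤ i → i ≤ j → j ≤ d → N P i j ≡ N Q i j)
    × (∀ (Q : EulerianPoset c ℓ₁ ℓ₂ d) →
         (∀ r → -1ℤ ≤ r → r ≤ d → f P r ≡ f Q r) →
         (∀ i j → 0ℤ < i + 1ℤ → i + 1ℤ < j → j < d - 1ℤ → N P i j ≡ N Q i j) →
         möbiusPolynomial P ≈ᴾ möbiusPolynomial Q)
mainTheorem18 {d = d} 3≤d P =
    möbius≈rank
  , (λ r _ _ → N-diagonal r , N-bottom r , N-top r)
  , N-edge
  , (λ i 1≤i _ → N-adjacent i (ℤ.≤-trans (+≤+ ℕ.z≤n) 1≤i))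
  , N-ridge
  , (λ i _ i≤d-3 → N-coatom i (ℤ.≤-trans i≤d-3 (ℤ.+-monoʳ-≤ d (-≤- (ℕ.s≤s ℕ.z≤n)))))
  , (λ Q f-agree N-agree → Determination.N-determined P Q f-agree N-agree)
  , (λ Q f-agree N-agree → Determination.möbiusPolynomial-determined P Q f-agree
      -- The strict bounds 0 < i + 1 < j < d - 1 describe the same integers as 0 ≤ i, i + 2 ≤ j ≤ d
      -- - 2.
      (λ i j 0≤i i+2≤j j≤d-2 → N-agree i j
        (ℤ.<-≤-trans (+<+ (ℕ.s≤s ℕ.z≤n)) (ℤ.+-monoˡ-≤ 1ℤ 0≤i))
        (ℤ.suc[i]≤j⇒i<j (subst (_≤ j) (suc-suc i) i+2≤j))
        (ℤ.≤-<-trans j≤d-2 (ℤ.+-monoʳ-< d (-<- (ℕ.s≤s ℕ.z≤n))))))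
  where
  open EulerianPosetProperties P
  suc-suc : ∀ i → i + + 2 ≡ 1ℤ + (i + 1ℤ)
  suc-suc = solve-∀
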